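{- Let $q$ be a power of an odd prime. Then in ${\rm PG}(4,q)$ there exist a set $\mathcal L$ of $q^3+1$ pairwise skew lines and a set $\mathcal P$ of $q^3+1$ planes any two of which intersect in exactly one point, such that no line of $\mathcal L$ is contained in a plane of $\mathcal P$. -}

module Defs where

open import Level using (Level; _⊔_) renaming (suc to lsuc)
open import Algebra.Bundles using (CommutativeRing)
import Algebra.Properties.Monoid.Sum as Sum
open import Data.Fin.Base using (Fin)
open import Data.Nat.Base using (ℕ; suc; _^_; _≤_)
open import Data.Nat.Primality using (Prime)
open import Data.Product using (∃; ∃₂; ∃!; _×_)
open import Data.Vec.Functional using (Vector; replicate; zipWith; map)
import Data.Vec.Functional.Relation.Binary.Equality.Setoid as VectorEquality
open import Function.Bundles using (Inverse)
open import Relation.Binary.Definitions using (_Respects_)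
open import Relation.Binary.PropositionalEquality using (_≡_; _≢_) renaming (setoid to ≡-setoid)
open import Relation.Nullary.Negation using (¬_)
open import Relation.Unary using (Pred; _∈_; _⊆_; _≐_)

PowerOfOddPrime : ℕ → Set
PowerOfOddPrime q = ∃₂ λ p k → Prime p × p ≢ 2 × 1 ≤ k × q ≡ p ^ k

record Field (c ℓ : Level) : Set (lsuc (c ⊔ ℓ)) where
  field
    commutativeRing : CommutativeRing c ℓ
  open CommutativeRing commutativeRing public
  field
    0≉1     : ¬ (0# ≈ 1#)
    inverse : ∀ x → ¬ (x ≈ 0#) → ∃ λ y → x * y ≈ 1#

HasOrder : ∀ {c ℓ} → Field c ℓ → ℕ → Set (c ⊔ ℓ)
HasOrder F q = Inverse (Field.setoid F) (≡-setoid (Fin q))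

-- The projective space of (projective) dimension n over F, i.e. the
-- lattice of linear subspaces of F^(n+1).
module PG {c ℓ : Level} (F : Field c ℓ) (n : ℕ) where

  open Field F
  open Sum +-monoid using (sum)
  open VectorEquality setoid using (_≋_)

  V : Set c
  V = Vector Carrier (suc n)

  0ᵛ : V
  0ᵛ = replicate (suc n) 0#

  _+ᵛ_ : V → V → V
  _+ᵛ_ = zipWith _+_

  _*ᵛ_ : Carrier → V → V
  a *ᵛ v = map (a *_) v

  linearCombination : ∀ {d} → Vector Carrier d → Vector V d → V
  linearCombination a b i = sum (λ j → a j * b j i)

  record IsSubspace (U : Pred V (c ⊔ ℓ)) : Set (c ⊔ ℓ) where
    field
      respects  : U Respects _≋_
      0-closed  : 0ᵛ ∈ U
      +-closed  : ∀ {u v} → u ∈ U → v ∈ U → (u +ᵛ v) ∈ U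
      *-closed  : ∀ a {v} → v ∈ U → (a *ᵛ v) ∈ U

  LinearlyIndependent : ∀ {d} → Vector V d → Set (c ⊔ ℓ)
  LinearlyIndependent b = ∀ a → linearCombination a b ≋ 0ᵛ → ∀ j → a j ≈ 0#

  record IsBasis {d} (U : Pred V (c ⊔ ℓ)) (b : Vector V d) : Set (c ⊔ ℓ) where
    field
      contained   : ∀ j → b j ∈ U
      independent : LinearlyIndependent b
      spanning    : ∀ {v} → v ∈ U → ∃ λ a → v ≋ linearCombination a b

  -- A projective subspace of projective dimension k has vector space
  -- dimension k + 1.
  record Flat (k : ℕ) : Set (lsuc (c ⊔ ℓ)) where
    field
      vectors    : Pred V (c ⊔ ℓ)
      isSubspace : IsSubspace vectors
      basis      : Vector V (suc k)
      isBasis    : IsBasis vectors basis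

  open Flat using (vectors)

  Point Line Plane : Set (lsuc (c ⊔ ℓ))
  Point = Flat 0
  Line  = Flat 1
  Plane = Flat 2

  infix 4 _≈ᶠ_ _⊑_

  -- The chosen basis is irrelevant to the identity of a flat.
  _≈ᶠ_ : ∀ {k} → Flat k → Flat k → Set (c ⊔ ℓ)
  A ≈ᶠ B = vectors A ≐ vectors B

  _⊑_ : ∀ {k m} → Flat k → Flat m → Set (c ⊔ ℓ)
  A ⊑ B = vectors A ⊆ vectors B

  CommonPoint : ∀ {k m} → Flat k → Flat m → Pred Point (c ⊔ ℓ)
  CommonPoint A B P = P ⊑ A × P ⊑ B

  Skew : Line → Line → Set (lsuc (c ⊔ ℓ))
  Skew A B = ¬ ∃ (CommonPoint A B)

  MeetInExactlyOnePoint : Plane → Plane → Set (lsuc (c ⊔ ℓ))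
  MeetInExactlyOnePoint A B = ∃! _≈ᶠ_ (CommonPoint A B)

{-# OPTIONS --safe #-}
module Submission where

open import Defs
open import Data.Fin.Base using (Fin)
open import Data.Nat.Base using (ℕ; _+_; _^_)
open import Data.Product using (Σ-syntax; _×_)
open import Function.Definitions using (Injective)
open import Relation.Binary.PropositionalEquality using (_≡_; _≢_)
open import Relation.Nullary.Negation using (¬_)

import Algebra.Properties.Ring as RingProperties
import Algebra.Properties.Semiring.Sum as SemiringSum
import Algebra.Solver.Ring.NaturalCoefficients.Default as RingSolver
open import Data.Empty using (⊥-elim)
open import Data.Fin.Base using (zero; suc; splitAt; _↑ˡ_; punchOut; combine; finToFun; funToFin)
open import Data.Fin.Patterns using (0F; 1F; 2F; 3F; 4F)
import Data.Fin.Properties as Fin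
open import Data.Maybe.Base using (Maybe; just; nothing)
open import Data.Maybe.Relation.Binary.Pointwise as Maybe using (just; nothing)
open import Data.Nat.Base using (zero; suc; _≤_; s≤s; nonTrivial⇒n>1)
open import Data.Nat.Primality using (prime⇒nonTrivial; prime⇒nonZero)
import Data.Nat.Properties as ℕ
open import Data.Product using (∃; _,_; proj₁; proj₂)
open import Data.Sum.Base using (inj₁; inj₂)
open import Data.Vec.Functional using (Vector; []; _∷_)
import Data.Vec.Functional.Relation.Binary.Equality.Setoid as VectorEquality
open import Function.Base using (_∘_)
open import Function.Bundles using (Inverse)
open import Level using (_⊔_)
open import Relation.Binary.Definitions using (Decidable)
import Relation.Binary.PropositionalEquality as ≡
import Relation.Binary.Reasoning.Setoid as SetoidReasoning
open import Relation.Nullary.Decidable using (Dec; yes; no; _×-dec_; map′; decidable-stable)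
open import Relation.Unary using (Pred; _∈_)

-- Write F⁵ = F² × F³ and let M be a 3 × 3 matrix without eigenvalues, here the
-- companion matrix of a cubic X³ − X − γ without roots.  The graphs
-- L_a = {(x, y; xa + yMa)}, a ∈ F³, together with any line of 0 × F³ form q³ + 1
-- pairwise skew lines, because M has no eigenvector.  Dually, for α ≠ 0 the
-- graphs P_b = {(Mᵀb · v, α (b · v); v)} together with any plane through F² × 0
-- form q³ + 1 planes meeting pairwise in a point: P_b ∩ P_b′ is spanned over the
-- vector d ⨯ Mᵀd with d = b − b′.  If L_a ⊆ P_b then 1 = Mᵀb · a and
-- 1 = α (b · Ma) = α (Mᵀb · a), which is impossible as soon as α ≠ 1.  The only
-- remaining incidences come from a = 0, b = 0; they disappear after replacing
-- the regulus of lines {(x, y; t(x, y, 0))}, t ∈ F ∪ {∞}, by the opposite one and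
-- taking (0, 0, 1) as the third generator of the plane through F² × 0.

-- Field arithmetic with -1 as a formal scalar.

module FieldProperties {c ℓ} (F : Field c ℓ) where

  open Field F hiding (_+_)
  open Field F using () renaming (_+_ to _⊕_)
  open RingProperties ring public using (+-cancelʳ)
  open SetoidReasoning setoid
  open RingSolver commutativeSemiring public using (solve; con; _:+_; _:*_; _:=_)

  -- X³ − X − γ has no root, stated without subtraction.
  Rootless : Carrier → Set _
  Rootless γ = ∀ x → ¬ (x * x * x ≈ γ ⊕ x)

  1≉0 : ¬ (1# ≈ 0#)
  1≉0 = 0≉1 ∘ sym

  -- Lets an identity be used under hypotheses: multiples of the hypotheses are added to the two
  -- sides until the semiring solver can prove them equal, and are then cancelled.
  cancel-equation : ∀ {a b x y} → x ≈ y → a ⊕ x ≈ b ⊕ y → a ≈ b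
  cancel-equation {a} {b} {x} {y} x≈y eq = +-cancelʳ x a b (trans eq (+-congˡ (sym x≈y)))

  *-zeroˡ-cong : ∀ {x} y → x ≈ 0# → x * y ≈ 0#
  *-zeroˡ-cong y x≈0 = trans (*-congʳ x≈0) (zeroˡ y)

  *-zeroʳ-cong : ∀ x {y} → y ≈ 0# → x * y ≈ 0#
  *-zeroʳ-cong x y≈0 = trans (*-congˡ y≈0) (zeroʳ x)

  *-cancelˡ : ∀ {x y z} → ¬ (x ≈ 0#) → x * y ≈ x * z → y ≈ z
  *-cancelˡ {x} {y} {z} x≉0 eq = let g , xg≈1 = inverse x x≉0 in begin
    y            ≈⟨ *-identityˡ y ⟨
    1# * y       ≈⟨ *-congʳ xg≈1 ⟨
    (x * g) * y  ≈⟨ solve 3 (λ x g y → (x :* g) :* y := g :* (x :* y)) refl x g y ⟩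
    g * (x * y)  ≈⟨ *-congˡ eq ⟩
    g * (x * z)  ≈⟨ solve 3 (λ x g y → (x :* g) :* y := g :* (x :* y)) refl x g z ⟨
    (x * g) * z  ≈⟨ *-congʳ xg≈1 ⟩
    1# * z       ≈⟨ *-identityˡ z ⟩
    z            ∎

  *≈0⇒≈0ʳ : ∀ {x y} → ¬ (x ≈ 0#) → x * y ≈ 0# → y ≈ 0#
  *≈0⇒≈0ʳ {x} x≉0 xy≈0 = *-cancelˡ x≉0 (trans xy≈0 (sym (zeroʳ x)))

  -- Signs are written as multiplication by −1 so that the semiring solver,
  -- which knows no negation, can treat −1 as a variable.
  -1# : Carrier
  -1# = - 1#

  1-1≈0 : 1# ⊕ -1# ≈ 0#
  1-1≈0 = -‿inverseʳ 1#

  x-x≈0 : ∀ x → x ⊕ -1# * x ≈ 0#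
  x-x≈0 x = begin
    x ⊕ -1# * x     ≈⟨ solve 2 (λ x m → x :+ m :* x := (con 1 :+ m) :* x) refl x -1# ⟩
    (1# ⊕ -1#) * x  ≈⟨ *-zeroˡ-cong x 1-1≈0 ⟩
    0#              ∎

  x≈y⇒x-y≈0 : ∀ {x y} → x ≈ y → x ⊕ -1# * y ≈ 0#
  x≈y⇒x-y≈0 {x} {y} x≈y = trans (+-congʳ x≈y) (x-x≈0 y)

  x-y≈0⇒x≈y : ∀ {x y} → x ⊕ -1# * y ≈ 0# → x ≈ y
  x-y≈0⇒x≈y {x} {y} eq = +-cancelʳ (-1# * y) x y (trans eq (sym (x-x≈0 y)))

  *-diag≈0 : Decidable _≈_ → ∀ {x} → x * x ≈ 0# → x ≈ 0#
  *-diag≈0 _≈?_ {x} xx≈0 with x ≈? 0#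
  ... | yes x≈0 = x≈0
  ... | no  x≉0 = *≈0⇒≈0ʳ x≉0 xx≈0

-- Dot and cross products in F³.

module Vectors₃ {c ℓ} (F : Field c ℓ) where

  open Field F hiding (_+_)
  open Field F using () renaming (_+_ to _⊕_)
  open FieldProperties F
  open SetoidReasoning setoid
  open VectorEquality setoid using (_≋_)

  K : Set c
  K = Vector Carrier 3

  _⊖_ : K → K → K
  (a ⊖ b) i = a i ⊕ -1# * b i

  infix 7 _·_
  _·_ : K → K → Carrier
  u · v = u 0F * v 0F ⊕ u 1F * v 1F ⊕ u 2F * v 2F

  _⨯_ : K → K → K
  u ⨯ w = (u 1F * w 2F ⊕ -1# * (u 2F * w 1F))
        ∷ (u 2F * w 0F ⊕ -1# * (u 0F * w 2F))
        ∷ (u 0F * w 1F ⊕ -1# * (u 1F * w 0F))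
        ∷ []

  ·-cong : ∀ {u u′ v v′} → u ≋ u′ → v ≋ v′ → u · v ≈ u′ · v′
  ·-cong p r = +-cong (+-cong (*-cong (p 0F) (r 0F)) (*-cong (p 1F) (r 1F))) (*-cong (p 2F) (r 2F))

  ·-⊖ : ∀ a b y → (a ⊖ b) · y ≈ a · y ⊕ -1# * (b · y)
  ·-⊖ a b y = solve 10
    (λ m a0 a1 a2 b0 b1 b2 y0 y1 y2 →
      (a0 :+ m :* b0) :* y0 :+ (a1 :+ m :* b1) :* y1 :+ (a2 :+ m :* b2) :* y2
      := (a0 :* y0 :+ a1 :* y1 :+ a2 :* y2) :+ m :* (b0 :* y0 :+ b1 :* y1 :+ b2 :* y2))
    refl -1# (a 0F) (a 1F) (a 2F) (b 0F) (b 1F) (b 2F) (y 0F) (y 1F) (y 2F)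

  ·-*ʳ : ∀ μ u v → u · (λ i → μ * v i) ≈ μ * (u · v)
  ·-*ʳ μ u v = solve 7
    (λ μ u0 u1 u2 v0 v1 v2 →
      u0 :* (μ :* v0) :+ u1 :* (μ :* v1) :+ u2 :* (μ :* v2)
      := μ :* (u0 :* v0 :+ u1 :* v1 :+ u2 :* v2))
    refl μ (u 0F) (u 1F) (u 2F) (v 0F) (v 1F) (v 2F)

  -- In the determinant with a repeated row every monomial occurs once plainly and once with `-1#`,
  -- so the sum is a multiple of `1# ⊕ -1#`.
  ⨯-orthogonalˡ : ∀ u w → u · (u ⨯ w) ≈ 0#
  ⨯-orthogonalˡ u w = trans
    (solve 7
      (λ m u0 u1 u2 w0 w1 w2 →
        u0 :* (u1 :* w2 :+ m :* (u2 :* w1)) :+ u1 :* (u2 :* w0 :+ m :* (u0 :* w2))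
          :+ u2 :* (u0 :* w1 :+ m :* (u1 :* w0))
        := (con 1 :+ m) :* (u0 :* u1 :* w2 :+ u1 :* u2 :* w0 :+ u2 :* u0 :* w1))
      refl -1# (u 0F) (u 1F) (u 2F) (w 0F) (w 1F) (w 2F))
    (*-zeroˡ-cong _ 1-1≈0)

  ⨯-orthogonalʳ : ∀ u w → w · (u ⨯ w) ≈ 0#
  ⨯-orthogonalʳ u w = trans
    (solve 7
      (λ m u0 u1 u2 w0 w1 w2 →
        w0 :* (u1 :* w2 :+ m :* (u2 :* w1)) :+ w1 :* (u2 :* w0 :+ m :* (u0 :* w2))
          :+ w2 :* (u0 :* w1 :+ m :* (u1 :* w0))
        := (con 1 :+ m) :* (w0 :* u1 :* w2 :+ w1 :* u2 :* w0 :+ w2 :* u0 :* w1))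
      refl -1# (u 0F) (u 1F) (u 2F) (w 0F) (w 1F) (w 2F))
    (*-zeroˡ-cong _ 1-1≈0)

  private
    -- This is the third coordinate of y ⨯ (u ⨯ w) = 0. Adding w2 (u · y) on the left, u2 (w · y) on
    -- the right and a multiple of `1# ⊕ -1#` on each side makes both sides the same polynomial.
    -- Scalar arguments let the other two coordinates follow by cyclic rotation.
    minor : ∀ u0 u1 u2 w0 w1 w2 y0 y1 y2 →
      u0 * y0 ⊕ u1 * y1 ⊕ u2 * y2 ≈ 0# → w0 * y0 ⊕ w1 * y1 ⊕ w2 * y2 ≈ 0# →
      y0 * (u2 * w0 ⊕ -1# * (u0 * w2)) ≈ y1 * (u1 * w2 ⊕ -1# * (u2 * w1))
    minor u0 u1 u2 w0 w1 w2 y0 y1 y2 hu hw = cancel-equation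
      (trans (+-cong (*-zeroʳ-cong w2 hu) (*-zeroˡ-cong (y1 * u2 * w1) 1-1≈0))
        (sym (+-cong (*-zeroʳ-cong u2 hw) (*-zeroˡ-cong (y0 * u0 * w2) 1-1≈0))))
      (solve 10
        (λ m u0 u1 u2 w0 w1 w2 y0 y1 y2 →
          y0 :* (u2 :* w0 :+ m :* (u0 :* w2))
            :+ (w2 :* (u0 :* y0 :+ u1 :* y1 :+ u2 :* y2) :+ (con 1 :+ m) :* (y1 :* u2 :* w1))
          := y1 :* (u1 :* w2 :+ m :* (u2 :* w1))
            :+ (u2 :* (w0 :* y0 :+ w1 :* y1 :+ w2 :* y2) :+ (con 1 :+ m) :* (y0 :* u0 :* w2)))
        refl -1# u0 u1 u2 w0 w1 w2 y0 y1 y2)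

    rotate : ∀ {x y z} → x ⊕ y ⊕ z ≈ 0# → y ⊕ z ⊕ x ≈ 0#
    rotate {x} {y} {z} = trans (solve 3 (λ x y z → y :+ z :+ x := x :+ y :+ z) refl x y z)

  -- y ⨯ (u ⨯ w) = (y · w) u − (y · u) w, which vanishes.
  orthogonal⇒∥⨯ : ∀ u w y → u · y ≈ 0# → w · y ≈ 0# → ∀ i j → y i * (u ⨯ w) j ≈ y j * (u ⨯ w) i
  orthogonal⇒∥⨯ u w y hu hw = go
    where
    01≈ : y 0F * (u ⨯ w) 1F ≈ y 1F * (u ⨯ w) 0F
    01≈ = minor _ _ _ _ _ _ _ _ _ hu hw
    12≈ : y 1F * (u ⨯ w) 2F ≈ y 2F * (u ⨯ w) 1F
    12≈ = minor _ _ _ _ _ _ _ _ _ (rotate hu) (rotate hw)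
    20≈ : y 2F * (u ⨯ w) 0F ≈ y 0F * (u ⨯ w) 2F
    20≈ = minor _ _ _ _ _ _ _ _ _ (rotate (rotate hu)) (rotate (rotate hw))
    go : ∀ i j → y i * (u ⨯ w) j ≈ y j * (u ⨯ w) i
    go 0F 0F = refl
    go 0F 1F = 01≈
    go 0F 2F = sym 20≈
    go 1F 0F = sym 01≈
    go 1F 1F = refl
    go 1F 2F = 12≈
    go 2F 0F = 20≈
    go 2F 1F = sym 12≈
    go 2F 2F = refl

  -- The factor is `y i` divided by the nonzero coordinate `(u ⨯ w) i`; proportionality of
  -- coordinates does the rest.
  orthogonal⇒multiple-⨯ : ∀ u w y i → ¬ ((u ⨯ w) i ≈ 0#) → u · y ≈ 0# → w · y ≈ 0# →
    ∃ λ μ → y ≋ (λ j → μ * (u ⨯ w) j)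
  orthogonal⇒multiple-⨯ u w y i n≉0 hu hw =
    let n = u ⨯ w ; g , ng≈1 = inverse (n i) n≉0 in
    y i * g , λ j → begin
      y j              ≈⟨ *-identityʳ _ ⟨
      y j * 1#         ≈⟨ *-congˡ ng≈1 ⟨
      y j * (n i * g)  ≈⟨ *-assoc _ _ _ ⟨
      y j * n i * g    ≈⟨ *-congʳ (orthogonal⇒∥⨯ u w y hu hw j i) ⟩
      y i * n j * g    ≈⟨ solve 3 (λ y n g → y :* n :* g := y :* g :* n) refl _ _ _ ⟩
      y i * g * n j    ∎

-- The companion matrix of X³ - X - γ and its pencil.

module Companion {c ℓ} (F : Field c ℓ) (_≈?_ : Decidable (Field._≈_ F))
  (γ : Field.Carrier F)
  (noRoot : FieldProperties.Rootless F γ) where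

  open Field F hiding (_+_)
  open Field F using () renaming (_+_ to _⊕_)
  open FieldProperties F
  open Vectors₃ F
  open SetoidReasoning setoid
  open VectorEquality setoid using (_≋_)

  -- `M` is multiplication by X on F[X]/(X³ - X - γ) in the basis 1, X, X².
  M Mᵀ : K → K
  M  a = γ * a 2F ∷ a 0F ⊕ a 2F ∷ a 1F ∷ []
  Mᵀ b = b 1F ∷ b 2F ∷ γ * b 0F ⊕ b 1F ∷ []

  Mᵀ-adjoint : ∀ b a → b · M a ≈ Mᵀ b · a
  Mᵀ-adjoint b a = solve 7
    (λ γ a0 a1 a2 b0 b1 b2 →
      b0 :* (γ :* a2) :+ b1 :* (a0 :+ a2) :+ b2 :* a1
      := b1 :* a0 :+ b2 :* a1 :+ (γ :* b0 :+ b1) :* a2)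
    refl γ (a 0F) (a 1F) (a 2F) (b 0F) (b 1F) (b 2F)

  M-⊖ : ∀ a b → M (a ⊖ b) ≋ M a ⊖ M b
  M-⊖ a b 0F = solve 4 (λ m γ a b → γ :* (a :+ m :* b) := γ :* a :+ m :* (γ :* b)) refl -1# γ (a 2F) (b 2F)
  M-⊖ a b 1F = solve 5 (λ m a a′ b b′ → a :+ m :* b :+ (a′ :+ m :* b′) := a :+ a′ :+ m :* (b :+ b′))
    refl -1# (a 0F) (a 2F) (b 0F) (b 2F)
  M-⊖ a b 2F = refl

  Mᵀ-⊖ : ∀ a b → Mᵀ (a ⊖ b) ≋ Mᵀ a ⊖ Mᵀ b
  Mᵀ-⊖ a b 0F = refl
  Mᵀ-⊖ a b 1F = refl
  Mᵀ-⊖ a b 2F = solve 6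
    (λ m γ a a′ b b′ → γ :* (a :+ m :* b) :+ (a′ :+ m :* b′) := γ :* a :+ a′ :+ m :* (γ :* b :+ b′))
    refl -1# γ (a 0F) (a 1F) (b 0F) (b 1F)

  -- The coordinates of the equation are γd₂ = xd₀, d₀ + d₂ = xd₁ and d₁ = xd₂. Together they give
  -- d₂x³ = d₂(γ + x), so d₂ ≠ 0 would make x a root; with d₂ = 0 the last two equations clear d₁
  -- and d₀.
  noEigenvector : ∀ x d → M d ≋ (λ i → x * d i) → ∀ i → d i ≈ 0#
  noEigenvector x d eq with d 2F ≈? 0#
  ... | no d₂≉0 = ⊥-elim (noRoot x (*-cancelˡ d₂≉0 (begin
      d 2F * (x * x * x)        ≈⟨ solve 2 (λ d x → d :* (x :* x :* x) := x :* (x :* (x :* d))) refl _ _ ⟩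
      x * (x * (x * d 2F))      ≈⟨ *-congˡ (*-congˡ (eq 2F)) ⟨
      x * (x * d 1F)            ≈⟨ *-congˡ (eq 1F) ⟨
      x * (d 0F ⊕ d 2F)         ≈⟨ distribˡ _ _ _ ⟩
      x * d 0F ⊕ x * d 2F       ≈⟨ +-congʳ (eq 0F) ⟨
      γ * d 2F ⊕ x * d 2F       ≈⟨ solve 3 (λ γ d x → γ :* d :+ x :* d := d :* (γ :+ x)) refl _ _ _ ⟩
      d 2F * (γ ⊕ x)            ∎)))
  ... | yes d₂≈0 = go
    where
    d₁≈0 : d 1F ≈ 0#
    d₁≈0 = trans (eq 2F) (*-zeroʳ-cong x d₂≈0)
    go : ∀ i → d i ≈ 0#
    go 0F = begin
      d 0F         ≈⟨ +-identityʳ _ ⟨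
      d 0F ⊕ 0#    ≈⟨ +-congˡ d₂≈0 ⟨
      d 0F ⊕ d 2F  ≈⟨ eq 1F ⟩
      x * d 1F     ≈⟨ *-zeroʳ-cong x d₁≈0 ⟩
      0#           ∎
    go 1F = d₁≈0
    go 2F = d₂≈0

  -- For y ≠ 0 a kernel vector of x + yM is an eigenvector of `M` for -x/y; for y = 0 the matrix is
  -- the nonzero scalar x.
  pencil-kernel : ∀ x y d → ¬ (x ≈ 0# × y ≈ 0#) → (∀ i → x * d i ⊕ y * M d i ≈ 0#) → ∀ i → d i ≈ 0#
  pencil-kernel x y d xy≉0 eq with y ≈? 0#
  ... | yes y≈0 = λ i → *≈0⇒≈0ʳ (λ x≈0 → xy≉0 (x≈0 , y≈0)) (begin
      x * d i               ≈⟨ +-identityʳ _ ⟨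
      x * d i ⊕ 0#          ≈⟨ +-congˡ (*-zeroˡ-cong (M d i) y≈0) ⟨
      x * d i ⊕ y * M d i   ≈⟨ eq i ⟩
      0#                    ∎)
  ... | no y≉0 = let g , yg≈1 = inverse y y≉0 in
    noEigenvector (-1# * x * g) d (λ i → *-cancelˡ y≉0 (begin
      y * M d i                  ≈⟨ opposite i ⟩
      -1# * (x * d i)            ≈⟨ *-identityʳ _ ⟨
      -1# * (x * d i) * 1#       ≈⟨ *-congˡ yg≈1 ⟨
      -1# * (x * d i) * (y * g)  ≈⟨ solve 5 (λ m x d y g → m :* (x :* d) :* (y :* g) := y :* (m :* x :* g :* d))
                                      refl -1# x (d i) y g ⟩
      y * (-1# * x * g * d i)    ∎))
    where
    opposite : ∀ i → y * M d i ≈ -1# * (x * d i)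
    opposite i = +-cancelʳ (x * d i) _ _ (begin
      y * M d i ⊕ x * d i        ≈⟨ +-comm _ _ ⟩
      x * d i ⊕ y * M d i        ≈⟨ eq i ⟩
      0#                         ≈⟨ x-x≈0 _ ⟨
      x * d i ⊕ -1# * (x * d i)  ≈⟨ +-comm _ _ ⟩
      -1# * (x * d i) ⊕ x * d i  ∎)

  pencil-injective : ∀ x y a b → ¬ (x ≈ 0# × y ≈ 0#) →
    (∀ i → x * a i ⊕ y * M a i ≈ x * b i ⊕ y * M b i) → a ≋ b
  pencil-injective x y a b xy≉0 eq i = x-y≈0⇒x≈y (pencil-kernel x y (a ⊖ b) xy≉0 (λ i → begin
    x * (a i ⊕ -1# * b i) ⊕ y * M (a ⊖ b) i              ≈⟨ +-congˡ (*-congˡ (M-⊖ a b i)) ⟩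
    x * (a i ⊕ -1# * b i) ⊕ y * (M a i ⊕ -1# * M b i)    ≈⟨ solve 7
      (λ m x y a b a′ b′ → x :* (a :+ m :* b) :+ y :* (a′ :+ m :* b′)
        := x :* a :+ y :* a′ :+ m :* (x :* b :+ y :* b′))
      refl -1# x y (a i) (b i) (M a i) (M b i) ⟩
    x * a i ⊕ y * M a i ⊕ -1# * (x * b i ⊕ y * M b i)    ≈⟨ x≈y⇒x-y≈0 (eq i) ⟩
    0#                                                   ∎) i)

  -- A vanishing product makes (d₀, d₁, d₂) parallel to `Mᵀ d` = (d₁, d₂, e). If d₀ ≠ 0, the ratio
  -- d₁/d₀ is an eigenvalue and hence a root. If d₀ = 0, then d₁² = d₀d₂ = 0 and d₂² = d₁e = 0.
  ⨯Mᵀ≈0⇒≈0 : ∀ d → (∀ i → (d ⨯ Mᵀ d) i ≈ 0#) → ∀ i → d i ≈ 0#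
  ⨯Mᵀ≈0⇒≈0 d n≈0 with d 0F ≈? 0#
  ... | yes d₀≈0 = λ { 0F → d₀≈0 ; 1F → d₁≈0 ; 2F → d₂≈0 }
    where
    d₁≈0 : d 1F ≈ 0#
    d₁≈0 = *-diag≈0 _≈?_ (trans (sym (x-y≈0⇒x≈y (n≈0 2F))) (*-zeroˡ-cong _ d₀≈0))
    d₂≈0 : d 2F ≈ 0#
    d₂≈0 = *-diag≈0 _≈?_ (trans (sym (x-y≈0⇒x≈y (n≈0 0F))) (*-zeroˡ-cong _ d₁≈0))
  ... | no d₀≉0 = let g , d₀g≈1 = inverse (d 0F) d₀≉0 ; e = Mᵀ d 2F in
    ⊥-elim (noRoot (d 1F * g) (begin
      d 1F * g * (d 1F * g) * (d 1F * g)      ≈⟨ solve 2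
        (λ d g → d :* g :* (d :* g) :* (d :* g) := d :* d :* (d :* (g :* g :* g))) refl _ _ ⟩
      d 1F * d 1F * (d 1F * (g * g * g))      ≈⟨ *-congʳ (x-y≈0⇒x≈y (n≈0 2F)) ⟨
      d 0F * d 2F * (d 1F * (g * g * g))      ≈⟨ solve 4
        (λ d0 d1 d2 g → d0 :* d2 :* (d1 :* (g :* g :* g)) := d2 :* d1 :* (d0 :* (g :* g :* g))) refl _ _ _ _ ⟩
      d 2F * d 1F * (d 0F * (g * g * g))      ≈⟨ *-congʳ (x-y≈0⇒x≈y (n≈0 1F)) ⟩
      d 0F * e * (d 0F * (g * g * g))         ≈⟨ solve 5
        (λ γ d0 d1 e g → d0 :* (γ :* d0 :+ d1) :* (d0 :* (g :* g :* g))
          := d0 :* g :* (d0 :* g) :* (γ :* (d0 :* g) :+ d1 :* g)) refl γ _ _ e _ ⟩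
      d 0F * g * (d 0F * g) * (γ * (d 0F * g) ⊕ d 1F * g)
        ≈⟨ *-cong (*-cong d₀g≈1 d₀g≈1) (+-congʳ (*-congˡ d₀g≈1)) ⟩
      1# * 1# * (γ * 1# ⊕ d 1F * g)           ≈⟨ solve 2
        (λ γ x → con 1 :* con 1 :* (γ :* con 1 :+ x) := γ :+ x) refl _ _ ⟩
      γ ⊕ d 1F * g                            ∎))

-- Spans, flats and their intersections.

module Flats {c ℓ} (F : Field c ℓ) (_≈?_ : Decidable (Field._≈_ F)) (n : ℕ) where

  open Field F hiding (_+_; zero)
  open Field F using () renaming (_+_ to _⊕_)
  open FieldProperties F
  open SemiringSum semiring using (sum; sum-cong-≋; *-distribˡ-sum; ∑-distrib-+; sum-replicate-zero)
  open SetoidReasoning setoid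
  open VectorEquality setoid using (_≋_)
  open PG F n

  Span : ∀ {d} → Vector V d → Pred V _
  Span b v = ∃ λ a → v ≋ linearCombination a b

  Span-isSubspace : ∀ {d} (b : Vector V d) → IsSubspace (Span b)
  Span-isSubspace {d} b = record
    { respects = λ { u≋v (a , u≋) → a , λ i → trans (sym (u≋v i)) (u≋ i) }
    ; 0-closed = (λ _ → 0#) , λ i →
        sym (trans (sum-cong-≋ (λ j → zeroˡ (b j i))) (sum-replicate-zero d))
    ; +-closed = λ { (a , u≋) (a′ , v≋) → (λ j → a j ⊕ a′ j) , λ i →
        trans (+-cong (u≋ i) (v≋ i))
          (sym (trans (sum-cong-≋ (λ j → distribʳ (b j i) (a j) (a′ j)))
            (∑-distrib-+ (λ j → a j * b j i) (λ j → a′ j * b j i)))) }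
    ; *-closed = λ { x (a , v≋) → (λ j → x * a j) , λ i →
        trans (*-congˡ (v≋ i))
          (trans (*-distribˡ-sum x (λ j → a j * b j i))
            (sum-cong-≋ (λ j → sym (*-assoc x (a j) (b j i))))) }
    }

  unit : ∀ {d} → Fin d → Vector Carrier d
  unit zero    zero    = 1#
  unit zero    (suc _) = 0#
  unit (suc _) zero    = 0#
  unit (suc j) (suc k) = unit j k

  sum-unit : ∀ {d} j (x : Vector Carrier d) → sum (λ k → unit j k * x k) ≈ x j
  sum-unit {suc d} zero x = begin
    1# * x zero ⊕ sum (λ k → 0# * x (suc k))
      ≈⟨ +-cong (*-identityˡ _) (trans (sum-cong-≋ (λ k → zeroˡ (x (suc k)))) (sum-replicate-zero d)) ⟩
    x zero ⊕ 0#  ≈⟨ +-identityʳ _ ⟩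
    x zero       ∎
  sum-unit (suc j) x = begin
    0# * x zero ⊕ sum (λ k → unit j k * x (suc k))  ≈⟨ +-cong (zeroˡ _) (sum-unit j (x ∘ suc)) ⟩
    0# ⊕ x (suc j)                                  ≈⟨ +-identityˡ _ ⟩
    x (suc j)                                       ∎

  span : ∀ {k} (b : Vector V (suc k)) → LinearlyIndependent b → Flat k
  span b independent = record
    { vectors    = Span b
    ; isSubspace = Span-isSubspace b
    ; basis      = b
    ; isBasis    = record
      { contained   = λ j → unit j , λ i → sym (sum-unit j (λ k → b k i))
      ; independent = independent
      ; spanning    = λ v∈ → v∈
      }
    }

  open Flat

  basis∈ : ∀ {k} (A : Flat k) j → basis A j ∈ vectors A
  basis∈ A = IsBasis.contained (isBasis A)

  unit-diag : ∀ {d} (j : Fin d) → unit j j ≈ 1#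
  unit-diag zero    = refl
  unit-diag (suc j) = unit-diag j

  -- Otherwise the coefficients `unit j` would form a nontrivial relation.
  basis≉0 : ∀ {k} (A : Flat k) j → ¬ (basis A j ≋ 0ᵛ)
  basis≉0 A j b≋0 = 1≉0 (trans (sym (unit-diag j))
    (IsBasis.independent (isBasis A) (unit j) (λ i → trans (sum-unit j (λ k → basis A k i)) (b≋0 i)) j))

  *ᵛ≈0⇒≈0 : ∀ {x v} → ¬ (v ≋ 0ᵛ) → (x *ᵛ v) ≋ 0ᵛ → x ≈ 0#
  *ᵛ≈0⇒≈0 {x} v≉0 xv≈0 with x ≈? 0#
  ... | yes x≈0 = x≈0
  ... | no  x≉0 = ⊥-elim (v≉0 (λ i → *≈0⇒≈0ʳ x≉0 (xv≈0 i)))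

  -- Speaks of vectors where `Skew` speaks of points. Since basis vectors are nonzero, it yields
  -- skewness as well as distinctness.
  TrivialIntersection : ∀ {k m} → Flat k → Flat m → Set _
  TrivialIntersection A B = ∀ v → v ∈ vectors A → v ∈ vectors B → v ≋ 0ᵛ

  TrivialIntersection-sym : ∀ {k m} (A : Flat k) (B : Flat m) →
    TrivialIntersection A B → TrivialIntersection B A
  TrivialIntersection-sym _ _ t v v∈B v∈A = t v v∈A v∈B

  trivial⇒skew : ∀ A B → TrivialIntersection A B → Skew A B
  trivial⇒skew A B t (P , P⊑A , P⊑B) =
    basis≉0 P 0F (t _ (P⊑A (basis∈ P 0F)) (P⊑B (basis∈ P 0F)))

  trivial⇒≉ : ∀ {k} (A B : Flat k) → TrivialIntersection A B → ¬ (A ≈ᶠ B)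
  trivial⇒≉ A B t (A⊑B , _) = basis≉0 A 0F (t _ (basis∈ A 0F) (A⊑B (basis∈ A 0F)))

  record IntersectionSpannedBy {k m} (A : Flat k) (B : Flat m) (w : V) : Set (c ⊔ ℓ) where
    field
      w∈A  : w ∈ vectors A
      w∈B  : w ∈ vectors B
      w≉0  : ¬ (w ≋ 0ᵛ)
      only : ∀ v → v ∈ vectors A → v ∈ vectors B → ∃ λ x → v ≋ (x *ᵛ w)

  IntersectionSpannedBy-sym : ∀ {k m} {A : Flat k} {B : Flat m} {w} →
    IntersectionSpannedBy A B w → IntersectionSpannedBy B A w
  IntersectionSpannedBy-sym s = record
    { w∈A = w∈B ; w∈B = w∈A ; w≉0 = w≉0 ; only = λ v v∈B v∈A → only v v∈A v∈B }
    where open IntersectionSpannedBy s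

  point : (w : V) → ¬ (w ≋ 0ᵛ) → Point
  point w w≉0 = span (w ∷ []) λ { a eq 0F →
    *ᵛ≈0⇒≈0 w≉0 (λ i → trans (sym (+-identityʳ _)) (eq i)) }

  point⊑ : ∀ {k} (A : Flat k) {w} (w≉0 : ¬ (w ≋ 0ᵛ)) → w ∈ vectors A → point w w≉0 ⊑ A
  point⊑ A w≉0 w∈A (a , v≋) = respects
    (λ i → sym (trans (v≋ i) (+-identityʳ _))) (*-closed (a 0F) w∈A)
    where open IsSubspace (isSubspace A)

  spanned⇒meetInExactlyOnePoint : ∀ {A B : Plane} {w} →
    IntersectionSpannedBy A B w → MeetInExactlyOnePoint A B
  spanned⇒meetInExactlyOnePoint {A} {B} {w} s =
    point w w≉0 , (point⊑ A w≉0 w∈A , point⊑ B w≉0 w∈B) , λ {Q} → unique Q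
    where
    open IntersectionSpannedBy s
    unique : ∀ Q → CommonPoint A B Q → point w w≉0 ≈ᶠ Q
    unique Q (Q⊑A , Q⊑B) = point⊑ Q w≉0 w∈Q , λ v∈Q →
      let x , v≋xw = only _ (Q⊑A v∈Q) (Q⊑B v∈Q) in
      (λ _ → x) , λ i → trans (v≋xw i) (sym (+-identityʳ _))
      where
      q = basis Q 0F
      w∈Q : w ∈ vectors Q
      w∈Q =
        -- The basis vector `q` of the point is x w with x ≠ 0, because `q` is nonzero; dividing by
        -- x brings `w` into `Q`.
        let x , q≋xw = only q (Q⊑A (basis∈ Q 0F)) (Q⊑B (basis∈ Q 0F))
            g , xg≈1 = inverse x (λ x≈0 → basis≉0 Q 0F (λ i → trans (q≋xw i) (*-zeroˡ-cong _ x≈0)))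
        in IsSubspace.respects (isSubspace Q)
          (λ i → begin
            g * q i        ≈⟨ *-congˡ (q≋xw i) ⟩
            g * (x * w i)  ≈⟨ solve 3 (λ g x w → g :* (x :* w) := x :* g :* w) refl _ _ _ ⟩
            x * g * w i    ≈⟨ *-congʳ xg≈1 ⟩
            1# * w i       ≈⟨ *-identityˡ _ ⟩
            w i            ∎)
          (IsSubspace.*-closed (isSubspace Q) g (basis∈ Q 0F))

  -- Equal planes would put two basis vectors b₀ = xw and b₁ = yw into the intersection. The
  -- relation yb₀ - xb₁ = 0 forces y = 0, and then b₁ = 0.
  spanned⇒≉ : ∀ {A B : Plane} {w} → IntersectionSpannedBy A B w → ¬ (A ≈ᶠ B)
  spanned⇒≉ {A} {B} {w} s (A⊑B , _) =
    let x , b₀≋ = only (b 0F) (basis∈ A 0F) (A⊑B (basis∈ A 0F))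
        y , b₁≋ = only (b 1F) (basis∈ A 1F) (A⊑B (basis∈ A 1F))
        y≈0 = IsBasis.independent (isBasis A) (y ∷ -1# * x ∷ 0# ∷ []) (λ i → begin
          y * b 0F i ⊕ (-1# * x * b 1F i ⊕ (0# * b 2F i ⊕ 0#))
            ≈⟨ +-cong (*-congˡ (b₀≋ i)) (+-congʳ (*-congˡ (b₁≋ i))) ⟩
          y * (x * w i) ⊕ (-1# * x * (y * w i) ⊕ (0# * b 2F i ⊕ 0#))
            ≈⟨ solve 5 (λ m x y w b → y :* (x :* w) :+ (m :* x :* (y :* w) :+ (con 0 :* b :+ con 0))
                 := y :* x :* w :+ m :* (y :* x :* w)) refl -1# x y (w i) (b 2F i) ⟩
          y * x * w i ⊕ -1# * (y * x * w i)
            ≈⟨ x-x≈0 _ ⟩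
          0# ∎) 0F
    in basis≉0 A 1F (λ i → trans (b₁≋ i) (*-zeroˡ-cong _ y≈0))
    where
    open IntersectionSpannedBy s
    b = basis A

-- The lines and planes with their equations.

module Configuration {c ℓ} (F : Field c ℓ) (_≈?_ : Decidable (Field._≈_ F))
  (γ : Field.Carrier F)
  (noRoot : FieldProperties.Rootless F γ)
  (α : Field.Carrier F)
  (α≉0 : ¬ Field._≈_ F α (Field.0# F)) (α≉1 : ¬ Field._≈_ F α (Field.1# F)) where

  open Field F hiding (_+_; zero)
  open Field F using () renaming (_+_ to _⊕_)
  open FieldProperties F
  open Vectors₃ F
  open Companion F _≈?_ γ noRoot
  open Flats F _≈?_ 4
  open PG F 4
  open Flat
  open SetoidReasoning setoid
  open VectorEquality setoid using (_≋_)

  private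
    -- `linearCombination` unfolds to a right-nested sum ending in `0#`. In the names below, a
    -- two-character suffix lists the entries of the two generators in the coordinate at hand.
    combination₂ : ∀ s t x y → s * x ⊕ (t * y ⊕ 0#) ≈ s * x ⊕ t * y
    combination₂ s t x y = +-congˡ (+-identityʳ _)

    combination₂-10 : ∀ s t → s * 1# ⊕ (t * 0# ⊕ 0#) ≈ s
    combination₂-10 = solve 2 (λ s t → s :* con 1 :+ (t :* con 0 :+ con 0) := s) refl

    combination₂-01 : ∀ s t → s * 0# ⊕ (t * 1# ⊕ 0#) ≈ t
    combination₂-01 = solve 2 (λ s t → s :* con 0 :+ (t :* con 1 :+ con 0) := t) refl

    combination₂-x0 : ∀ s t x → s * x ⊕ (t * 0# ⊕ 0#) ≈ s * x
    combination₂-x0 = solve 3 (λ s t x → s :* x :+ (t :* con 0 :+ con 0) := s :* x) refl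

    combination₂-0x : ∀ s t x → s * 0# ⊕ (t * x ⊕ 0#) ≈ t * x
    combination₂-0x = solve 3 (λ s t x → s :* con 0 :+ (t :* x :+ con 0) := t :* x) refl

    combination₂-00 : ∀ s t → s * 0# ⊕ (t * 0# ⊕ 0#) ≈ 0#
    combination₂-00 = solve 2 (λ s t → s :* con 0 :+ (t :* con 0 :+ con 0) := con 0) refl

    combination₃-· : ∀ (a b : K) → a 0F * b 0F ⊕ (a 1F * b 1F ⊕ (a 2F * b 2F ⊕ 0#)) ≈ b · a
    combination₃-· a b = solve 6
      (λ a0 a1 a2 b0 b1 b2 → a0 :* b0 :+ (a1 :* b1 :+ (a2 :* b2 :+ con 0))
        := b0 :* a0 :+ b1 :* a1 :+ b2 :* a2)
      refl (a 0F) (a 1F) (a 2F) (b 0F) (b 1F) (b 2F)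

    combination₃-α· : ∀ (a b : K) →
      a 0F * (α * b 0F) ⊕ (a 1F * (α * b 1F) ⊕ (a 2F * (α * b 2F) ⊕ 0#)) ≈ α * (b · a)
    combination₃-α· a b = solve 7
      (λ α a0 a1 a2 b0 b1 b2 → a0 :* (α :* b0) :+ (a1 :* (α :* b1) :+ (a2 :* (α :* b2) :+ con 0))
        := α :* (b0 :* a0 :+ b1 :* a1 :+ b2 :* a2))
      refl α (a 0F) (a 1F) (a 2F) (b 0F) (b 1F) (b 2F)

    combination₃-unit : ∀ (a : K) i →
      a 0F * unit 0F i ⊕ (a 1F * unit 1F i ⊕ (a 2F * unit 2F i ⊕ 0#)) ≈ a i
    combination₃-unit a 0F = solve 3 (λ x y z → x :* con 1 :+ (y :* con 0 :+ (z :* con 0 :+ con 0)) := x)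
      refl (a 0F) (a 1F) (a 2F)
    combination₃-unit a 1F = solve 3 (λ x y z → x :* con 0 :+ (y :* con 1 :+ (z :* con 0 :+ con 0)) := y)
      refl (a 0F) (a 1F) (a 2F)
    combination₃-unit a 2F = solve 3 (λ x y z → x :* con 0 :+ (y :* con 0 :+ (z :* con 1 :+ con 0)) := z)
      refl (a 0F) (a 1F) (a 2F)

  tail₂ : V → K
  tail₂ v i = v (suc (suc i))

  graphLine : K → Line
  graphLine a = span ((1# ∷ 0# ∷ a) ∷ (0# ∷ 1# ∷ M a) ∷ []) λ
    { r eq 0F → trans (sym (combination₂-10 (r 0F) (r 1F))) (eq 0F)
    ; r eq 1F → trans (sym (combination₂-01 (r 0F) (r 1F))) (eq 1F)
    }

  -- The first two coordinates of a vector on the line are its coefficients in the chosen basis.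
  graphLine-equation : ∀ a {v} → v ∈ vectors (graphLine a) →
    ∀ i → tail₂ v i ≈ v 0F * a i ⊕ v 1F * M a i
  graphLine-equation a {v} (r , v≋) i = begin
    v (suc (suc i))                     ≈⟨ v≋ (suc (suc i)) ⟩
    r 0F * a i ⊕ (r 1F * M a i ⊕ 0#)    ≈⟨ combination₂ _ _ _ _ ⟩
    r 0F * a i ⊕ r 1F * M a i           ≈⟨ +-cong (*-congʳ (trans (v≋ 0F) (combination₂-10 _ _)))
                                                  (*-congʳ (trans (v≋ 1F) (combination₂-01 _ _))) ⟨
    v 0F * a i ⊕ v 1F * M a i           ∎

  -- A line of the regulus opposite to the one formed by the graph lines of the
  -- scalar multiples of (1, 0, 0) and the line {(0, 0, *, *, 0)}.
  rulingLine : ∀ x y → ¬ (x ≈ 0# × y ≈ 0#) → Line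
  rulingLine x y xy≉0 =
    span ((x ∷ y ∷ 0# ∷ 0# ∷ 0# ∷ []) ∷ (0# ∷ 0# ∷ x ∷ y ∷ 0# ∷ []) ∷ []) λ
      { r eq 0F → annihilates (trans (sym (combination₂-x0 (r 0F) (r 1F) x)) (eq 0F))
                              (trans (sym (combination₂-x0 (r 0F) (r 1F) y)) (eq 1F))
      ; r eq 1F → annihilates (trans (sym (combination₂-0x (r 0F) (r 1F) x)) (eq 2F))
                              (trans (sym (combination₂-0x (r 0F) (r 1F) y)) (eq 3F))
      }
    where
    annihilates : ∀ {s} → s * x ≈ 0# → s * y ≈ 0# → s ≈ 0#
    annihilates {s} sx≈0 sy≈0 with s ≈? 0#
    ... | yes s≈0 = s≈0
    ... | no  s≉0 = ⊥-elim (xy≉0 (*≈0⇒≈0ʳ s≉0 sx≈0 , *≈0⇒≈0ʳ s≉0 sy≈0))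

  rulingLine-coordinates : ∀ {x y} xy≉0 {v} → v ∈ vectors (rulingLine x y xy≉0) →
    ∃ λ s → ∃ λ t → v ≋ (s * x ∷ s * y ∷ t * x ∷ t * y ∷ 0# ∷ [])
  rulingLine-coordinates {x} {y} xy≉0 (r , v≋) = r 0F , r 1F , λ
    { 0F → trans (v≋ 0F) (combination₂-x0 _ _ _)
    ; 1F → trans (v≋ 1F) (combination₂-x0 _ _ _)
    ; 2F → trans (v≋ 2F) (combination₂-0x _ _ _)
    ; 3F → trans (v≋ 3F) (combination₂-0x _ _ _)
    ; 4F → trans (v≋ 4F) (combination₂-00 _ _)
    }

  graphPlane : K → Plane
  graphPlane b = span (λ j → Mᵀ b j ∷ α * b j ∷ unit j) λ r eq j →
    trans (sym (combination₃-unit r j)) (eq (suc (suc j)))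

  -- The generators end in the unit vectors, so the coefficients are the last three coordinates.
  graphPlane-equations : ∀ b {v} → v ∈ vectors (graphPlane b) →
    v 0F ≈ Mᵀ b · tail₂ v × v 1F ≈ α * (b · tail₂ v)
  graphPlane-equations b {v} (r , v≋) =
    trans (v≋ 0F) (trans (combination₃-· r (Mᵀ b)) (·-cong {Mᵀ b} (λ _ → refl) r≋)) ,
    trans (v≋ 1F) (trans (combination₃-α· r b) (*-congˡ (·-cong {b} (λ _ → refl) r≋)))
    where
    r≋ : r ≋ tail₂ v
    r≋ i = sym (trans (v≋ (suc (suc i))) (combination₃-unit r i))

  equations⇒graphPlane : ∀ b {v} → v 0F ≈ Mᵀ b · tail₂ v → v 1F ≈ α * (b · tail₂ v) →
    v ∈ vectors (graphPlane b)
  equations⇒graphPlane b {v} v₀≈ v₁≈ = tail₂ v , λ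
    { 0F            → trans v₀≈ (sym (combination₃-· (tail₂ v) (Mᵀ b)))
    ; 1F            → trans v₁≈ (sym (combination₃-α· (tail₂ v) b))
    ; (suc (suc i)) → sym (combination₃-unit (tail₂ v) i)
    }

  plane∞ : Plane
  plane∞ = span ((1# ∷ 0# ∷ 0# ∷ 0# ∷ 0# ∷ []) ∷ (0# ∷ 1# ∷ 0# ∷ 0# ∷ 0# ∷ [])
    ∷ (0# ∷ 0# ∷ 0# ∷ 0# ∷ 1# ∷ []) ∷ []) λ
      { r eq 0F → trans (sym (combination₃-unit r 0F)) (eq 0F)
      ; r eq 1F → trans (sym (combination₃-unit r 1F)) (eq 1F)
      ; r eq 2F → trans (sym (combination₃-unit r 2F)) (eq 4F)
      }

  private
    combination₃-0 : ∀ x y z → x * 0# ⊕ (y * 0# ⊕ (z * 0# ⊕ 0#)) ≈ 0#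
    combination₃-0 = solve 3
      (λ x y z → x :* con 0 :+ (y :* con 0 :+ (z :* con 0 :+ con 0)) := con 0) refl

  plane∞-equations : ∀ {v} → v ∈ vectors plane∞ → v 2F ≈ 0# × v 3F ≈ 0#
  plane∞-equations (r , v≋) =
    trans (v≋ 2F) (combination₃-0 _ _ _) , trans (v≋ 3F) (combination₃-0 _ _ _)

  equations⇒plane∞ : ∀ {v} → v 2F ≈ 0# → v 3F ≈ 0# → v ∈ vectors plane∞
  equations⇒plane∞ {v} v₂≈0 v₃≈0 = r , λ
    { 0F → sym (combination₃-unit r 0F)
    ; 1F → sym (combination₃-unit r 1F)
    ; 2F → trans v₂≈0 (sym (combination₃-0 _ _ _))
    ; 3F → trans v₃≈0 (sym (combination₃-0 _ _ _))
    ; 4F → sym (combination₃-unit r 2F)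
    }
    where
    r : K
    r = v 0F ∷ v 1F ∷ v 4F ∷ []

  -- Pairwise intersections.

  graphLines-trivial : ∀ {a b} → ¬ (a ≋ b) → TrivialIntersection (graphLine a) (graphLine b)
  graphLines-trivial {a} {b} a≉b v v∈a v∈b with (v 0F ≈? 0#) ×-dec (v 1F ≈? 0#)
  -- On a common vector the pencil member v₀ + v₁M takes the same value at `a` and `b`; being
  -- nonzero, it is injective.
  ... | no v₀₁≉0 = ⊥-elim (a≉b (pencil-injective (v 0F) (v 1F) a b v₀₁≉0
          (λ i → trans (sym (graphLine-equation a v∈a i)) (graphLine-equation b v∈b i))))
  ... | yes (v₀≈0 , v₁≈0) = λ
    { 0F            → v₀≈0
    ; 1F            → v₁≈0
    ; (suc (suc i)) → trans (graphLine-equation a v∈a i)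
        (trans (+-cong (*-zeroˡ-cong _ v₀≈0) (*-zeroˡ-cong _ v₁≈0)) (+-identityʳ _))
    }

  rulingLine-zero : ∀ {s t} x y {v} → s ≈ 0# → t ≈ 0# →
    v ≋ (s * x ∷ s * y ∷ t * x ∷ t * y ∷ 0# ∷ []) → v ≋ 0ᵛ
  rulingLine-zero x y s≈0 t≈0 v≋ = λ
    { 0F → trans (v≋ 0F) (*-zeroˡ-cong x s≈0)
    ; 1F → trans (v≋ 1F) (*-zeroˡ-cong y s≈0)
    ; 2F → trans (v≋ 2F) (*-zeroˡ-cong x t≈0)
    ; 3F → trans (v≋ 3F) (*-zeroˡ-cong y t≈0)
    ; 4F → v≋ 4F
    }

  -- A common vector begins with s(x, y) = s′(x′, y′), followed by t(x, y) = t′(x′, y′). A nonzero s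
  -- or t would make (x : y) and (x′ : y′) proportional, against the determinant condition.
  rulingLines-trivial : ∀ {x y x′ y′} xy≉0 x′y′≉0 → ¬ (x * y′ ≈ y * x′) →
    TrivialIntersection (rulingLine x y xy≉0) (rulingLine x′ y′ x′y′≉0)
  rulingLines-trivial {x} {y} {x′} {y′} xy≉0 x′y′≉0 det≉0 v v∈ v∈′ =
    let s  , t  , v≋  = rulingLine-coordinates xy≉0 v∈
        s′ , t′ , v≋′ = rulingLine-coordinates x′y′≉0 v∈′
    in rulingLine-zero x y
      (vanishes (trans (sym (v≋ 0F)) (v≋′ 0F)) (trans (sym (v≋ 1F)) (v≋′ 1F)))
      (vanishes (trans (sym (v≋ 2F)) (v≋′ 2F)) (trans (sym (v≋ 3F)) (v≋′ 3F)))
      v≋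
    where
    vanishes : ∀ {s s′} → s * x ≈ s′ * x′ → s * y ≈ s′ * y′ → s ≈ 0#
    vanishes {s} {s′} eqx eqy with s ≈? 0#
    ... | yes s≈0 = s≈0
    ... | no  s≉0 = ⊥-elim (det≉0 (*-cancelˡ s≉0 (begin
      s * (x * y′)     ≈⟨ *-assoc _ _ _ ⟨
      s * x * y′       ≈⟨ *-congʳ eqx ⟩
      s′ * x′ * y′     ≈⟨ solve 3 (λ s x y → s :* x :* y := s :* y :* x) refl _ _ _ ⟩
      s′ * y′ * x′     ≈⟨ *-congʳ eqy ⟨
      s * y * x′       ≈⟨ *-assoc _ _ _ ⟩
      s * (y * x′)     ∎)))

  M-* : ∀ s a → M (λ i → s * a i) ≋ (λ i → s * M a i)
  M-* s a 0F = solve 3 (λ γ s a → γ :* (s :* a) := s :* (γ :* a)) refl γ s (a 2F)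
  M-* s a 1F = sym (distribˡ s (a 0F) (a 2F))
  M-* s a 2F = refl

  -- A common vector (sx, sy; t(x, y, 0)) satisfies (x + yM)(sa) = (x + yM)(t, 0, 0).
  graphLine-rulingLine-trivial : ∀ {a x y} → ¬ (a 1F ≈ 0# × a 2F ≈ 0#) → ∀ xy≉0 →
    TrivialIntersection (graphLine a) (rulingLine x y xy≉0)
  graphLine-rulingLine-trivial {a} {x} {y} a₁₂≉0 xy≉0 v v∈ v∈′ =
    let s , t , v≋ = rulingLine-coordinates xy≉0 v∈′
        sa≋ = pencil-injective x y (λ i → s * a i) (t ∷ 0# ∷ 0# ∷ []) xy≉0 (equal v≋)
        s≈0 = vanishes (sa≋ 1F) (sa≋ 2F)
    in rulingLine-zero x y s≈0 (trans (sym (sa≋ 0F)) (*-zeroˡ-cong _ s≈0)) v≋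
    where
    vanishes : ∀ {s} → s * a 1F ≈ 0# → s * a 2F ≈ 0# → s ≈ 0#
    vanishes {s} eq₁ eq₂ with s ≈? 0#
    ... | yes s≈0 = s≈0
    ... | no  s≉0 = ⊥-elim (a₁₂≉0 (*≈0⇒≈0ʳ s≉0 eq₁ , *≈0⇒≈0ʳ s≉0 eq₂))

    pencil-e₀ : ∀ t → (t * x ∷ t * y ∷ 0# ∷ []) ≋
      (λ i → x * (t ∷ 0# ∷ 0# ∷ []) i ⊕ y * M (t ∷ 0# ∷ 0# ∷ []) i)
    pencil-e₀ t 0F = solve 4 (λ γ x y t → t :* x := x :* t :+ y :* (γ :* con 0)) refl γ x y t
    pencil-e₀ t 1F = solve 3 (λ x y t → t :* y := x :* con 0 :+ y :* (t :+ con 0)) refl x y t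
    pencil-e₀ t 2F = solve 2 (λ x y → con 0 := x :* con 0 :+ y :* con 0) refl x y

    equal : ∀ {s t} → v ≋ (s * x ∷ s * y ∷ t * x ∷ t * y ∷ 0# ∷ []) → ∀ i →
      x * (s * a i) ⊕ y * M (λ i → s * a i) i ≈ x * (t ∷ 0# ∷ 0# ∷ []) i ⊕ y * M (t ∷ 0# ∷ 0# ∷ []) i
    equal {s} {t} v≋ i = begin
      x * (s * a i) ⊕ y * M (λ i → s * a i) i
        ≈⟨ +-congˡ (*-congˡ (M-* s a i)) ⟩
      x * (s * a i) ⊕ y * (s * M a i)
        ≈⟨ solve 5 (λ x y s a b → x :* (s :* a) :+ y :* (s :* b) := s :* x :* a :+ s :* y :* b) refl x y s (a i) (M a i) ⟩
      s * x * a i ⊕ s * y * M a i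
        ≈⟨ +-cong (*-congʳ (v≋ 0F)) (*-congʳ (v≋ 1F)) ⟨
      v 0F * a i ⊕ v 1F * M a i
        ≈⟨ graphLine-equation a v∈ i ⟨
      tail₂ v i
        ≈⟨ tail≋ i ⟩
      (t * x ∷ t * y ∷ 0# ∷ []) i
        ≈⟨ pencil-e₀ t i ⟩
      x * (t ∷ 0# ∷ 0# ∷ []) i ⊕ y * M (t ∷ 0# ∷ 0# ∷ []) i ∎
      where
      tail≋ : tail₂ v ≋ (t * x ∷ t * y ∷ 0# ∷ [])
      tail≋ 0F = v≋ 2F
      tail≋ 1F = v≋ 3F
      tail≋ 2F = v≋ 4F

  onGraphPlane : K → K → V
  onGraphPlane b y = Mᵀ b · y ∷ α * (b · y) ∷ y

  onGraphPlane∈ : ∀ b y → onGraphPlane b y ∈ vectors (graphPlane b)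
  onGraphPlane∈ b y = equations⇒graphPlane b refl refl

  -- The plane's equations are linear in the tail, so scaling the tail scales the whole vector.
  graphPlane-multiple : ∀ b {v x y} → v ∈ vectors (graphPlane b) → tail₂ v ≋ (λ i → x * y i) →
    v ≋ (x *ᵛ onGraphPlane b y)
  graphPlane-multiple b {v} {x} {y} v∈ v≋ = λ
    { 0F → trans (proj₁ equations) (scale (Mᵀ b))
    ; 1F → begin
        v 1F               ≈⟨ proj₂ equations ⟩
        α * (b · tail₂ v)  ≈⟨ *-congˡ (scale b) ⟩
        α * (x * (b · y))  ≈⟨ solve 3 (λ α x z → α :* (x :* z) := x :* (α :* z)) refl α x (b · y) ⟩
        x * (α * (b · y))  ∎
    ; (suc (suc i)) → v≋ i
    }
    where
    equations : v 0F ≈ Mᵀ b · tail₂ v × v 1F ≈ α * (b · tail₂ v)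
    equations = graphPlane-equations b v∈
    scale : ∀ u → u · tail₂ v ≈ x * (u · y)
    scale u = trans (·-cong {u} (λ _ → refl) v≋) (·-*ʳ x u y)

  -- The equations of the two planes agree over a tail y exactly when d · y = 0 and `Mᵀ d` · y = 0.
  -- As d ≠ 0, the vector n is nonzero and spans these tails.
  graphPlanes-meet : ∀ {b b′} → ¬ (b ≋ b′) → ∃ (IntersectionSpannedBy (graphPlane b) (graphPlane b′))
  graphPlanes-meet {b} {b′} b≉b′ = onGraphPlane b n , record
    { w∈A  = onGraphPlane∈ b n
    ; w∈B  = equations⇒graphPlane b′
        (x-y≈0⇒x≈y (trans (sym (Mᵀd· n)) (⨯-orthogonalʳ d (Mᵀ d))))
        (*-congˡ (x-y≈0⇒x≈y (trans (sym (·-⊖ b b′ n)) (⨯-orthogonalˡ d (Mᵀ d)))))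
    ; w≉0  = λ w≋0 → n≉0 (λ i → w≋0 (suc (suc i)))
    ; only = λ v v∈ v∈′ →
        let v₀≈ , v₁≈ = graphPlane-equations b v∈
            v₀≈′ , v₁≈′ = graphPlane-equations b′ v∈′
            i , nᵢ≉0 = Fin.¬∀⟶∃¬ 3 _ (λ i → n i ≈? 0#) n≉0
            -- Subtracting the equations of the planes gives both orthogonality relations; the one
            -- for d needs the factor `α` cancelled first.
            x , tail≋ = orthogonal⇒multiple-⨯ d (Mᵀ d) (tail₂ v) i nᵢ≉0
              (trans (·-⊖ b b′ (tail₂ v)) (x≈y⇒x-y≈0 (*-cancelˡ α≉0 (trans (sym v₁≈) v₁≈′))))
              (trans (Mᵀd· (tail₂ v)) (x≈y⇒x-y≈0 (trans (sym v₀≈) v₀≈′)))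
        in x , graphPlane-multiple b v∈ tail≋
    }
    where
    d n : K
    d = b ⊖ b′
    n = d ⨯ Mᵀ d
    n≉0 : ¬ (∀ i → n i ≈ 0#)
    n≉0 n≈0 = b≉b′ (λ i → x-y≈0⇒x≈y (⨯Mᵀ≈0⇒≈0 d n≈0 i))
    Mᵀd· : ∀ y → Mᵀ d · y ≈ Mᵀ b · y ⊕ -1# * (Mᵀ b′ · y)
    Mᵀd· y = trans (·-cong {Mᵀ d} {Mᵀ b ⊖ Mᵀ b′} {y} (Mᵀ-⊖ b b′) (λ _ → refl)) (·-⊖ (Mᵀ b) (Mᵀ b′) y)

  -- `plane∞` leaves only tails of the form (0, 0, z).
  graphPlane-plane∞-meet : ∀ b → ∃ (IntersectionSpannedBy (graphPlane b) plane∞)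
  graphPlane-plane∞-meet b = onGraphPlane b (unit 2F) , record
    { w∈A  = onGraphPlane∈ b (unit 2F)
    ; w∈B  = equations⇒plane∞ refl refl
    ; w≉0  = λ w≋0 → 1≉0 (w≋0 4F)
    ; only = λ v v∈ v∈∞ → let v₂≈0 , v₃≈0 = plane∞-equations v∈∞ in
        v 4F , graphPlane-multiple b v∈ λ
          { 0F → trans v₂≈0 (sym (zeroʳ _))
          ; 1F → trans v₃≈0 (sym (zeroʳ _))
          ; 2F → sym (*-identityʳ _)
          }
    }

  -- No line lies in a plane.

  graphLine⋢graphPlane : ∀ a b → ¬ (graphLine a ⊑ graphPlane b)
  graphLine⋢graphPlane a b L⊑P = α≉1 (begin
    α                ≈⟨ *-identityʳ α ⟨
    α * 1#           ≈⟨ *-congˡ (proj₁ (graphPlane-equations b (L⊑P (basis∈ (graphLine a) 0F)))) ⟩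
    α * (Mᵀ b · a)   ≈⟨ *-congˡ (Mᵀ-adjoint b a) ⟨
    α * (b · M a)    ≈⟨ proj₂ (graphPlane-equations b (L⊑P (basis∈ (graphLine a) 1F))) ⟨
    1#               ∎)

  -- Containment of the two generators means a₀ = a₁ = 0 and a₀ + a₂ = 0, so a = 0, one of the
  -- switched parameters.
  graphLine⋢plane∞ : ∀ a → ¬ (a 1F ≈ 0# × a 2F ≈ 0#) → ¬ (graphLine a ⊑ plane∞)
  graphLine⋢plane∞ a a₁₂≉0 L⊑P = a₁₂≉0 (proj₂ first , (begin
    a 2F         ≈⟨ +-identityˡ _ ⟨
    0# ⊕ a 2F    ≈⟨ +-congʳ (proj₁ first) ⟨
    a 0F ⊕ a 2F  ≈⟨ proj₂ (plane∞-equations (L⊑P (basis∈ (graphLine a) 1F))) ⟩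
    0#           ∎))
    where
    first : a 0F ≈ 0# × a 1F ≈ 0#
    first = plane∞-equations (L⊑P (basis∈ (graphLine a) 0F))

  -- The first generator (x, y; 0) has zero tail, and the only such vector on a graph plane is 0.
  rulingLine⋢graphPlane : ∀ {x y} xy≉0 b → ¬ (rulingLine x y xy≉0 ⊑ graphPlane b)
  rulingLine⋢graphPlane {x} {y} xy≉0 b L⊑P =
    let x≈ , y≈ = graphPlane-equations b (L⊑P (basis∈ (rulingLine x y xy≉0) 0F)) in
    xy≉0 (trans x≈ (·-zeroʳ (Mᵀ b)) , trans y≈ (*-zeroʳ-cong α (·-zeroʳ b)))
    where
    ·-zeroʳ : ∀ u → u · (0# ∷ 0# ∷ 0# ∷ []) ≈ 0#
    ·-zeroʳ u = solve 3 (λ x y z → x :* con 0 :+ y :* con 0 :+ z :* con 0 := con 0) refl (u 0F) (u 1F) (u 2F)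

  -- The second generator has x and y in the two coordinates that vanish on `plane∞`.
  rulingLine⋢plane∞ : ∀ {x y} xy≉0 → ¬ (rulingLine x y xy≉0 ⊑ plane∞)
  rulingLine⋢plane∞ xy≉0 L⊑P = xy≉0 (plane∞-equations (L⊑P (basis∈ (rulingLine _ _ xy≉0) 1F)))

  -- Labelling both families by F³ and one extra symbol.

  Index : Set c
  Index = Maybe K

  _≃_ : Index → Index → Set _
  _≃_ = Maybe.Pointwise _≋_

  1y≉0 : ∀ {y} → ¬ (1# ≈ 0# × y ≈ 0#)
  1y≉0 = 1≉0 ∘ proj₁

  01≉0 : ¬ (0# ≈ 0# × 1# ≈ 0#)
  01≉0 = 1≉0 ∘ proj₂

  -- The parameters (p, 0, 0), whose graph lines were switched away, label the
  -- ruling lines (1 : p); the remaining label ∞ goes to (0 : 1).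
  lineAt : (a : K) → Dec (a 1F ≈ 0# × a 2F ≈ 0#) → Line
  lineAt a (yes _) = rulingLine 1# (a 0F) 1y≉0
  lineAt a (no  _) = graphLine a

  switched? : (a : K) → Dec (a 1F ≈ 0# × a 2F ≈ 0#)
  switched? a = (a 1F ≈? 0#) ×-dec (a 2F ≈? 0#)

  line : Index → Line
  line (just a) = lineAt a (switched? a)
  line nothing  = rulingLine 0# 1# 01≉0

  plane : Index → Plane
  plane (just b) = graphPlane b
  plane nothing  = plane∞

  -- Stated for arbitrary decisions `p` and `r`, so that cases are split by matching on them without
  -- unfolding `switched?`.
  lineAt-trivial : ∀ a b p r → ¬ (a ≋ b) → TrivialIntersection (lineAt a p) (lineAt b r)
  lineAt-trivial a b (no a₁₂≉0) (no b₁₂≉0) a≉b = graphLines-trivial a≉b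
  lineAt-trivial a b (no a₁₂≉0) (yes _)    a≉b = graphLine-rulingLine-trivial a₁₂≉0 1y≉0
  lineAt-trivial a b (yes _)    (no b₁₂≉0) a≉b =
    TrivialIntersection-sym (graphLine b) (rulingLine 1# (a 0F) 1y≉0)
      (graphLine-rulingLine-trivial b₁₂≉0 1y≉0)
  lineAt-trivial a b (yes (a₁≈0 , a₂≈0)) (yes (b₁≈0 , b₂≈0)) a≉b = rulingLines-trivial 1y≉0 1y≉0 λ eq → a≉b λ
    { 0F → trans (sym (*-identityʳ _)) (trans (sym eq) (*-identityˡ _))
    ; 1F → trans a₁≈0 (sym b₁≈0)
    ; 2F → trans a₂≈0 (sym b₂≈0)
    }

  lineAt-∞-trivial : ∀ a p → TrivialIntersection (lineAt a p) (line nothing)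
  lineAt-∞-trivial a (no a₁₂≉0) = graphLine-rulingLine-trivial a₁₂≉0 01≉0
  lineAt-∞-trivial a (yes _)    = rulingLines-trivial 1y≉0 01≉0 λ eq →
    1≉0 (trans (sym (*-identityˡ 1#)) (trans eq (zeroʳ (a 0F))))

  lines-trivial : ∀ i j → ¬ (i ≃ j) → TrivialIntersection (line i) (line j)
  lines-trivial (just a) (just b) i≄j = lineAt-trivial a b (switched? a) (switched? b) (i≄j ∘ just)
  lines-trivial (just a) nothing  i≄j = lineAt-∞-trivial a (switched? a)
  lines-trivial nothing  (just b) i≄j =
    TrivialIntersection-sym (line (just b)) (line nothing) (lineAt-∞-trivial b (switched? b))
  lines-trivial nothing  nothing  i≄j = ⊥-elim (i≄j nothing)

  planes-meet : ∀ i j → ¬ (i ≃ j) → ∃ (IntersectionSpannedBy (plane i) (plane j))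
  planes-meet (just a) (just b) i≄j = graphPlanes-meet (i≄j ∘ just)
  planes-meet (just a) nothing  i≄j = graphPlane-plane∞-meet a
  planes-meet nothing  (just b) i≄j =
    let w , s = graphPlane-plane∞-meet b in w , IntersectionSpannedBy-sym {A = graphPlane b} {B = plane∞} s
  planes-meet nothing  nothing  i≄j = ⊥-elim (i≄j nothing)

  lineAt⋢plane : ∀ a p j → ¬ (lineAt a p ⊑ plane j)
  lineAt⋢plane a (yes _)    (just b) = rulingLine⋢graphPlane 1y≉0 b
  lineAt⋢plane a (yes _)    nothing  = rulingLine⋢plane∞ 1y≉0
  lineAt⋢plane a (no _)     (just b) = graphLine⋢graphPlane a b
  lineAt⋢plane a (no a₁₂≉0) nothing  = graphLine⋢plane∞ a a₁₂≉0

  line⋢plane : ∀ i j → ¬ (line i ⊑ plane j)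
  line⋢plane (just a) j        = lineAt⋢plane a (switched? a) j
  line⋢plane nothing  (just b) = rulingLine⋢graphPlane 01≉0 b
  line⋢plane nothing  nothing  = rulingLine⋢plane∞ 01≉0

-- Counting in finite sets.

missesValue : ∀ {n} (f : Fin n → Fin n) {i j} → i ≢ j → f i ≡ f j → ∃ λ k → ∀ x → f x ≢ k
missesValue {suc n} f {i} {j} i≢j fi≡fj =
  -- Being a value of `f` is decidable by search, so the failure of surjectivity produces an actual
  -- `k`.
  let k , ¬hit = Fin.¬∀⟶∃¬ (suc n) (λ k → ∃ λ x → f x ≡ k) (λ k → Fin.any? (λ x → f x Fin.≟ k)) ¬surjective
  in k , λ x fx≡k → ¬hit (x , fx≡k)
  where
  -- A section of f omits one of the two colliding arguments.
  sectionOmitting : (s : ∀ k → ∃ λ x → f x ≡ k) → ∀ m → ¬ (∀ k → m ≢ proj₁ (s k))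
  sectionOmitting s m m≢g = ℕ.1+n≰n (Fin.injective⇒≤ {f = λ k → punchOut (m≢g k)} λ {k} {l} eq →
    ≡.trans (≡.sym (proj₂ (s k)))
      (≡.trans (≡.cong f (Fin.punchOut-injective (m≢g k) (m≢g l) eq)) (proj₂ (s l))))

  ¬surjective : ¬ (∀ k → ∃ λ x → f x ≡ k)
  ¬surjective s with i Fin.≟ proj₁ (s (f i))
  ... | no i≢ = sectionOmitting s i λ k i≡gk →
    i≢ (≡.trans i≡gk (≡.cong (proj₁ ∘ s) (≡.trans (≡.sym (proj₂ (s k))) (≡.cong f (≡.sym i≡gk)))))
  -- The section picks `i` over the value shared with `j`, hence never `j`.
  ... | yes i≡ = sectionOmitting s j λ k j≡gk → i≢j (≡.trans i≡ (≡.sym (≡.trans j≡gk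
    (≡.cong (proj₁ ∘ s) (≡.trans (≡.sym (proj₂ (s k))) (≡.trans (≡.cong f (≡.sym j≡gk)) (≡.sym fi≡fj)))))))

avoidTwo : ∀ {n} → 3 ≤ n → (i j : Fin n) → ∃ λ k → k ≢ i × k ≢ j
avoidTwo (s≤s (s≤s (s≤s _))) i j with 0F Fin.≟ i | 0F Fin.≟ j | 1F Fin.≟ i | 1F Fin.≟ j
... | no 0≢i     | no 0≢j     | _          | _          = 0F , 0≢i , 0≢j
... | yes ≡.refl | _          | _          | no 1≢j     = 1F , (λ ()) , 1≢j
... | yes ≡.refl | _          | _          | yes ≡.refl = 2F , (λ ()) , (λ ())
... | no _       | yes ≡.refl | no 1≢i     | _          = 1F , 1≢i , (λ ())
... | no _       | yes ≡.refl | yes ≡.refl | _          = 2F , (λ ()) , (λ ())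

-- q ≥ p ≥ 3. The bound leaves room for a scalar `α` other than 0 and 1.
powerOfOddPrime⇒3≤ : ∀ {q} → PowerOfOddPrime q → 3 ≤ q
powerOfOddPrime⇒3≤ (p , suc k , p-prime , p≢2 , _ , ≡.refl) =
  ℕ.≤-trans (ℕ.≤∧≢⇒< (nonTrivial⇒n>1 p) (≡.≢-sym p≢2)) (ℕ.m≤m*n p (p ^ k))
  where instance
    _ = prime⇒nonTrivial p-prime
    _ = prime⇒nonZero p-prime
    _ = ℕ.m^n≢0 p k

-- The digit functions agree only pointwise, so `funToFin` must be shown to respect this before the
-- round trip applies.
finToFun-injective : ∀ {m n} {i j : Fin (n ^ m)} →
  (∀ k → finToFun {n} {m} i k ≡ finToFun {n} {m} j k) → i ≡ j
finToFun-injective {m} {n} {i} {j} eq = ≡.trans (≡.sym (Fin.funToFin-finToFin {m} {n} i))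
  (≡.trans (funToFin-cong {m} eq) (Fin.funToFin-finToFin {m} {n} j))
  where
  funToFin-cong : ∀ {m n} {f g : Fin m → Fin n} → (∀ k → f k ≡ g k) → funToFin f ≡ funToFin g
  funToFin-cong {zero}  f≗g = ≡.refl
  funToFin-cong {suc m} f≗g = ≡.cong₂ combine (f≗g zero) (funToFin-cong (f≗g ∘ suc))

-- Decidability, parameters and enumeration from the order q.

module FiniteField {c ℓ} {q} (F : Field c ℓ) (order : HasOrder F q) where

  open Field F hiding (_+_; zero)
  open Field F using () renaming (_+_ to _⊕_)
  open FieldProperties F
  open Inverse order using (to; from; to-cong; from-cong; strictlyInverseˡ; strictlyInverseʳ)
  open SetoidReasoning setoid
  open VectorEquality setoid using (_≋_)

  to-injective : ∀ {x y} → to x ≡ to y → x ≈ y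
  to-injective {x} {y} eq =
    trans (sym (strictlyInverseʳ x)) (trans (from-cong eq) (strictlyInverseʳ y))

  from-injective : ∀ {i j} → from i ≈ from j → i ≡ j
  from-injective {i} {j} eq =
    ≡.trans (≡.sym (strictlyInverseˡ i)) (≡.trans (to-cong eq) (strictlyInverseˡ j))

  _≈?_ : Decidable _≈_
  x ≈? y = map′ to-injective to-cong (to x Fin.≟ to y)

  -- x ↦ x³ − x takes the value 0 at both 0 and 1, hence omits some value.
  rootless : ∃ Rootless
  rootless =
    let k , misses = missesValue (to ∘ cubic ∘ from) {to 0#} {to 1#} (λ eq → 0≉1 (to-injective eq))
          (to-cong (trans (trans (cubic-cong (strictlyInverseʳ 0#)) cubic-0)
            (sym (trans (cubic-cong (strictlyInverseʳ 1#)) cubic-1))))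
    in from k , λ x eq → misses (to x) (≡.trans
      (to-cong (trans (cubic-cong (strictlyInverseʳ x)) (value eq))) (strictlyInverseˡ k))
    where
    cubic : Carrier → Carrier
    cubic x = x * x * x ⊕ -1# * x
    cubic-cong : ∀ {x y} → x ≈ y → cubic x ≈ cubic y
    cubic-cong x≈y = +-cong (*-cong (*-cong x≈y x≈y) x≈y) (*-congˡ x≈y)
    cubic-0 : cubic 0# ≈ 0#
    cubic-0 = solve 1 (λ m → con 0 :* con 0 :* con 0 :+ m :* con 0 := con 0) refl -1#
    cubic-1 : cubic 1# ≈ 0#
    cubic-1 = trans (solve 1 (λ m → con 1 :* con 1 :* con 1 :+ m :* con 1 := con 1 :+ m) refl -1#) 1-1≈0
    value : ∀ {γ x} → x * x * x ≈ γ ⊕ x → cubic x ≈ γ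
    value {γ} {x} eq = begin
      x * x * x ⊕ -1# * x    ≈⟨ +-congʳ eq ⟩
      γ ⊕ x ⊕ -1# * x        ≈⟨ +-assoc _ _ _ ⟩
      γ ⊕ (x ⊕ -1# * x)      ≈⟨ +-congˡ (x-x≈0 x) ⟩
      γ ⊕ 0#                 ≈⟨ +-identityʳ γ ⟩
      γ                      ∎

  third : 3 ≤ q → ∃ λ α → ¬ (α ≈ 0#) × ¬ (α ≈ 1#)
  third 3≤q =
    let k , k≢0 , k≢1 = avoidTwo 3≤q (to 0#) (to 1#)
        avoids : ∀ {x} → k ≢ to x → ¬ (from k ≈ x)
        avoids k≢x eq = k≢x (≡.trans (≡.sym (strictlyInverseˡ k)) (to-cong eq))
    in from k , avoids k≢0 , avoids k≢1

  index : ∀ m → Fin (q ^ m + 1) → Maybe (Vector Carrier m)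
  index m i with splitAt (q ^ m) i
  ... | inj₁ k = just (λ j → from (finToFun k j))
  ... | inj₂ _ = nothing

  index-injective : ∀ m (i j : Fin (q ^ m + 1)) → Maybe.Pointwise _≋_ (index m i) (index m j) → i ≡ j
  index-injective m i j i≃j with splitAt (q ^ m) i in eqi | splitAt (q ^ m) j in eqj | i≃j
  ... | inj₁ k  | inj₁ l  | just k≋l = ≡.trans (≡.sym (Fin.splitAt⁻¹-↑ˡ eqi)) (≡.trans
    (≡.cong (_↑ˡ 1) (finToFun-injective {m} (λ j → from-injective (k≋l j)))) (Fin.splitAt⁻¹-↑ˡ eqj))
  -- Only unmixed cases survive the match on `i≃j`, and the right summand `Fin 1` has `0F` alone.
  ... | inj₂ 0F | inj₂ 0F | nothing  = ≡.trans (≡.sym (Fin.splitAt⁻¹-↑ʳ eqi)) (Fin.splitAt⁻¹-↑ʳ eqj)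

theorem2p5 : ∀ {c ℓ} (q : ℕ) → PowerOfOddPrime q →
    (F : Field c ℓ) → HasOrder F q →
    let open PG F 4 in
    Σ[ 𝓛 ∈ (Fin (q ^ 3 + 1) → Line) ] Σ[ 𝓟 ∈ (Fin (q ^ 3 + 1) → Plane) ]
    Injective _≡_ _≈ᶠ_ 𝓛 ×
    Injective _≡_ _≈ᶠ_ 𝓟 ×
    (∀ i j → i ≢ j → Skew (𝓛 i) (𝓛 j)) ×
    (∀ i j → i ≢ j → MeetInExactlyOnePoint (𝓟 i) (𝓟 j)) ×
    (∀ i j → ¬ (𝓛 i ⊑ 𝓟 j))
theorem2p5 q q-odd F order =
  𝓛 , 𝓟 ,
  -- Flats with different indices are known to be distinct; decidable equality of indices turns this
  -- into injectivity.
  (λ {i} {j} 𝓛i≈𝓛j → decidable-stable (i Fin.≟ j) λ i≢j →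
    trivial⇒≉ (𝓛 i) (𝓛 j) (trivial i j i≢j) 𝓛i≈𝓛j) ,
  (λ {i} {j} 𝓟i≈𝓟j → decidable-stable (i Fin.≟ j) λ i≢j →
    spanned⇒≉ (proj₂ (meet i j i≢j)) 𝓟i≈𝓟j) ,
  (λ i j i≢j → trivial⇒skew (𝓛 i) (𝓛 j) (trivial i j i≢j)) ,
  (λ i j i≢j → spanned⇒meetInExactlyOnePoint (proj₂ (meet i j i≢j))) ,
  (λ i j → line⋢plane (index 3 i) (index 3 j))
  where
  open FiniteField F order
  α-data = third (powerOfOddPrime⇒3≤ q-odd)
  open Configuration F _≈?_ (proj₁ rootless) (proj₂ rootless)
    (proj₁ α-data) (proj₁ (proj₂ α-data)) (proj₂ (proj₂ α-data))
  open Flats F _≈?_ 4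
  open PG F 4
  𝓛 : Fin (q ^ 3 + 1) → Line
  𝓛 i = line (index 3 i)
  𝓟 : Fin (q ^ 3 + 1) → Plane
  𝓟 i = plane (index 3 i)
  trivial : ∀ i j → i ≢ j → TrivialIntersection (𝓛 i) (𝓛 j)
  trivial i j i≢j = lines-trivial (index 3 i) (index 3 j) (i≢j ∘ index-injective 3 i j)
  meet : ∀ i j → i ≢ j → ∃ (IntersectionSpannedBy (𝓟 i) (𝓟 j))
  meet i j i≢j = planes-meet (index 3 i) (index 3 j) (i≢j ∘ index-injective 3 i j)
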